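{- Let $S={a_1 \choose b_1},\dots,{a_n \choose b_n}$ be a nonempty sequence of tuples of nonnegative integers, with no zero tuple and with $\sum_{i=1}^n a_i=\sum_{i=1}^n b_i$, whose numbering is the given topological order. Suppose that the source tuples of $S$ are exactly its first $q$ tuples and that they are numbered such that $b_1\ge b_2\ge\dots\ge b_q$; thus ${a_{q+1} \choose b_{q+1}}$ is the first tuple that is not a source tuple. Let $S'$ be the sequence $$S':={a_1 \choose b_1-1},\dots,{a_{a_{q+1}} \choose b_{a_{q+1}}-1},\dots,{a_q \choose b_q},{0 \choose b_{q+1}},{a_{q+2}\choose b_{q+2}},\dots,{a_n \choose b_n},$$ obtained from $S$ by subtracting $1$ from the second entry of each of the first $a_{q+1}$ source tuples and replacing the first entry of the $(q+1)$-st tuple by $0$ (this is defined when $a_{q+1}\le q$), then deleting all zero tuples and renumbering the remaining tuples consecutively from $1$ while keeping their order; this numbering is the given topological order for $S'$. Then $S$ is a dag sequence for its given topological order if and only if $a_{q+1}\le q$ and $S'$ is a dag sequence for its given topological order.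
   Context: A dag is an acyclic digraph without parallel arcs. A sequence $S={a_1 \choose b_1},\dots,{a_n \choose b_n}$ with $a_i,b_i\in\mathbb{Z}_{\ge 0}$ is a dag sequence for a given topological order if there is a dag $G=(V,A)$ with labeled vertex set $V=\{v_1,\dots,v_n\}$ such that $v_i$ has indegree $a_i$ and outdegree $b_i$ for all $i$ and such that $v_1,\dots,v_n$ is a topological ordering of $G$, i.e. every arc $(v_i,v_j)\in A$ satisfies $i<j$. The empty sequence is regarded as a dag sequence for its (empty) topological order. A tuple ${a \choose b}$ is a zero tuple if $a=b=0$ and a source tuple if $a=0,b>0$. -}

module Defs where

open import Data.Bool using (Bool; T)
open import Data.Fin using (Fin; toℕ; fromℕ<)
import Data.Fin as Fin
open import Data.Fin.Subset using (Subset; ∣_∣)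
open import Data.List using (List; []; _∷_; _++_; map; take; drop; filter; length; lookup)
open import Data.List.Relation.Unary.Linked using (Linked)
open import Data.Nat using (ℕ; pred; suc; _≤_; _≥_; _<_; _>_; _≟_)
open import Data.Product using (Σ-syntax; _×_; _,_; proj₁; proj₂; map₂)
open import Data.Vec using (tabulate)
open import Function.Bundles using (_⇔_)
open import Relation.Binary.Construct.Closure.Transitive using (TransClosure)
open import Relation.Binary.PropositionalEquality using (_≡_)
open import Relation.Nullary using (¬_; ¬?; _×-dec_)
open import Relation.Unary using (Decidable)

-- A Boolean adjacency matrix excludes parallel arcs by construction; loops and
-- longer directed cycles are excluded by acyclicity.
record Dag (n : ℕ) : Set where
  field
    adj : Fin n → Fin n → Bool

  Arc : Fin n → Fin n → Set
  Arc u v = T (adj u v)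

  field
    acyclic : ∀ v → ¬ TransClosure Arc v v

  inNeighbours outNeighbours : Fin n → Subset n
  inNeighbours  v = tabulate (λ u → adj u v)
  outNeighbours v = tabulate (λ w → adj v w)

  indegree outdegree : Fin n → ℕ
  indegree  v = ∣ inNeighbours v ∣
  outdegree v = ∣ outNeighbours v ∣

  -- The numbering of the vertices is a topological ordering.
  Topological : Set
  Topological = ∀ u v → Arc u v → u Fin.< v

-- (a , b) : prescribed indegree a and outdegree b.
Tuple : Set
Tuple = ℕ × ℕ

-- The given topological order is the order of the list.
DagSequence : List Tuple → Set
DagSequence S =
  Σ[ G ∈ Dag (length S) ]
    (∀ i → Dag.indegree G i ≡ proj₁ (lookup S i)) ×
    (∀ i → Dag.outdegree G i ≡ proj₂ (lookup S i)) ×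
    Dag.Topological G

ZeroTuple SourceTuple : Tuple → Set
ZeroTuple   (a , b) = a ≡ 0 × b ≡ 0
SourceTuple (a , b) = a ≡ 0 × b > 0

zeroTuple? : Decidable ZeroTuple
zeroTuple? (a , b) = (a ≟ 0) ×-dec (b ≟ 0)

SourcesAreFirst : ℕ → List Tuple → Set
SourcesAreFirst q S =
  q ≤ length S × (∀ i → SourceTuple (lookup S i) ⇔ toℕ i < q)

OutdegreesNonincreasing : List Tuple → Set
OutdegreesNonincreasing S = Linked _≥_ (map proj₂ S)

-- The (q+1)-st tuple: positions are counted from 0.
firstNonSource : (S : List Tuple) (q : ℕ) → q < length S → Tuple
firstNonSource S q q<n = lookup S (fromℕ< q<n)

-- S′.  When the first q tuples are source tuples, pred is only applied to
-- positive numbers.  The value is meaningful only if a ≤ q; for a > q, `take`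
-- truncates to all q of them.
reduced : (S : List Tuple) (q : ℕ) → q < length S → List Tuple
reduced S q q<n = filter (λ t → ¬? (zeroTuple? t))
  ( map (map₂ pred) (take a sources) ++ drop a sources
  ++ (0 , b) ∷ drop (suc q) S )
  where
  sources = take q S
  a = proj₁ (firstNonSource S q q<n)
  b = proj₂ (firstNonSource S q q<n)

{-# OPTIONS --safe #-}
module Submission where

-- Build a dag along the topological order, remembering only the list of
-- outdegrees still owed by the vertices already passed: a new vertex (a , b)
-- decrements a of the entries and adds the entry b.  A dag exists iff all entries
-- can be brought to zero, and zero entries never matter.  If a list containing
-- x + 1 and y with y ≤ x can be completed, then so can the one with x and y + 1
-- instead.  Hence the first non-source vertex may always decrement the largest
-- entries, which are the first ones.

open import Defs
open import Data.Bool using (Bool; true; false; T; if_then_else_)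
open import Data.Empty using (⊥-elim)
open import Data.Fin using (Fin; zero; suc; toℕ; fromℕ<)
import Data.Fin as Fin
import Data.Fin.Properties as Fin
open import Data.Fin.Subset using (∣_∣)
open import Data.List using (List; []; _∷_; _++_; map; take; drop; filter; length; lookup; sum; tabulate)
open import Data.List.Properties using (map-++; map-∘; take-map; drop-map; ++-identityʳ; ++-assoc; length-map; length-take; take-all)
open import Data.List.Relation.Binary.Permutation.Propositional using (_↭_; refl; prep; swap; trans; ↭-sym)
open import Data.List.Relation.Binary.Permutation.Propositional.Properties using (All-resp-↭; shift; shifts; ++⁺ˡ)
open import Data.List.Relation.Unary.All using (All; []; _∷_)
import Data.List.Relation.Unary.All as All
open import Data.List.Relation.Unary.All.Properties using (tabulate⁺; tabulate⁻; map⁺; ++⁺; take⁺; drop⁺)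
open import Data.List.Relation.Unary.AllPairs using (AllPairs; []; _∷_)
open import Data.List.Relation.Unary.Linked.Properties using (Linked⇒AllPairs)
open import Data.Nat using (ℕ; zero; suc; pred; _+_; _≤_; _<_; _≥_; _>_; z≤n; s≤s; s≤s⁻¹)
open import Data.Nat.Properties using (+-assoc; +-comm; +-identityʳ; <⇒≤; ≤-refl; ≤-trans; m≤n⇒m≤1+n; m≤n⇒m<n∨m≡n; m≤n⇒m⊓n≡m)
open import Data.Product using (Σ-syntax; ∃-syntax; _×_; _,_; proj₁; proj₂; map₂)
open import Data.Sum using (inj₁; inj₂)
import Data.Vec as Vec
import Data.Vec.Functional as Vector
open import Function using (_∘_; flip)
open import Function.Bundles using (_⇔_; mk⇔; Equivalence)
open import Relation.Binary.Construct.Closure.Transitive using (TransClosure; [_]; _∷_)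
open import Relation.Binary.PropositionalEquality using (_≡_; _≢_; refl; sym; cong; cong₂; subst; module ≡-Reasoning)
  renaming (trans to ≡-trans)
open import Relation.Nullary using (¬_; ¬?)

-- Lists of owed outdegrees

private
  variable
    a b k m x y : ℕ
    P P′ Q : List ℕ
    S : List Tuple

-- Each entry is lowered at most once, which excludes parallel arcs, and only if positive, so no
-- vertex exceeds its outdegree.
data Decrement : ℕ → List ℕ → List ℕ → Set where
  []    : Decrement 0 [] []
  skip  : Decrement k P P′ → Decrement k (x ∷ P) (x ∷ P′)
  lower : Decrement k P P′ → Decrement (suc k) (suc x ∷ P) (x ∷ P′)

-- The list P holds the outdegrees still owed by the vertices already passed;
-- the next vertex (a , b) draws its incoming arcs from a of them.
Realizable : List ℕ → List Tuple → Set
Realizable P []            = All (_≡ 0) P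
Realizable P ((a , b) ∷ S) = ∃[ P′ ] Decrement a P P′ × Realizable (b ∷ P′) S

decrement-↭ : Decrement k P P′ → P ↭ Q → ∃[ Q′ ] Decrement k Q Q′ × P′ ↭ Q′
decrement-↭ d                 refl         = _ , d , refl
decrement-↭ (skip d)          (prep _ p)   = let _ , e , r = decrement-↭ d p in _ , skip e , prep _ r
decrement-↭ (lower d)         (prep _ p)   = let _ , e , r = decrement-↭ d p in _ , lower e , prep _ r
decrement-↭ (skip (skip d))   (swap _ _ p) = let _ , e , r = decrement-↭ d p in _ , skip (skip e) , swap _ _ r
decrement-↭ (skip (lower d))  (swap _ _ p) = let _ , e , r = decrement-↭ d p in _ , lower (skip e) , swap _ _ r
decrement-↭ (lower (skip d))  (swap _ _ p) = let _ , e , r = decrement-↭ d p in _ , skip (lower e) , swap _ _ r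
decrement-↭ (lower (lower d)) (swap _ _ p) = let _ , e , r = decrement-↭ d p in _ , lower (lower e) , swap _ _ r
decrement-↭ d                 (trans p q)  =
  let _ , e , r = decrement-↭ d p
      _ , f , s = decrement-↭ e q
  in _ , f , trans r s

-- Each choice of entries follows them through the permutation, so later vertices see only a
-- multiset. This lets any entry be moved to the front.
realizable-↭ : ∀ S → P ↭ Q → Realizable P S → Realizable Q S
realizable-↭ []      p r            = All-resp-↭ p r
realizable-↭ (_ ∷ S) p (_ , d , r) =
  let _ , e , s = decrement-↭ d p in _ , e , realizable-↭ S (prep _ s) r

decrement-none : ∀ P → Decrement 0 P P
decrement-none []      = []
decrement-none (_ ∷ P) = skip (decrement-none P)

decrement-none⁻ : Decrement 0 P P′ → P ≡ P′
decrement-none⁻ []       = refl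
decrement-none⁻ (skip d) = cong (_ ∷_) (decrement-none⁻ d)

decrement-≤length : Decrement k P P′ → k ≤ length P
decrement-≤length []       = z≤n
decrement-≤length (skip d) = m≤n⇒m≤1+n (decrement-≤length d)
decrement-≤length (lower d) = s≤s (decrement-≤length d)

-- Zero entries, zero tuples and source tuples

0∷-realizable : ∀ S → Realizable P S → Realizable (0 ∷ P) S
0∷-realizable []      r           = refl ∷ r
0∷-realizable (_ ∷ S) (_ , d , r) =
  _ , skip d , realizable-↭ S (swap 0 _ refl) (0∷-realizable S r)

0∷-realizable⁻ : ∀ S → Realizable (0 ∷ P) S → Realizable P S
0∷-realizable⁻ []      (_ ∷ r)          = r
0∷-realizable⁻ (_ ∷ S) (_ , skip d , r) =
  _ , d , 0∷-realizable⁻ S (realizable-↭ S (swap _ 0 refl) r)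

source-realizable : ∀ S → Realizable (b ∷ P) S → Realizable P ((0 , b) ∷ S)
source-realizable _ r = _ , decrement-none _ , r

source-realizable⁻ : ∀ S → Realizable P ((0 , b) ∷ S) → Realizable (b ∷ P) S
source-realizable⁻ S (_ , d , r) with refl ← decrement-none⁻ d = r

nonzero : List Tuple → List Tuple
nonzero = filter (λ t → ¬? (zeroTuple? t))

-- A zero tuple draws no arcs and adds a zero entry, which can only ever be skipped.
nonzero-realizable : ∀ S → Realizable P S → Realizable P (nonzero S)
nonzero-realizable []                r           = r
nonzero-realizable ((0 , 0) ∷ S)     r           =
  nonzero-realizable S (0∷-realizable⁻ S (source-realizable⁻ S r))
nonzero-realizable ((0 , suc _) ∷ S) (_ , d , r) = _ , d , nonzero-realizable S r
nonzero-realizable ((suc _ , _) ∷ S) (_ , d , r) = _ , d , nonzero-realizable S r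

nonzero-realizable⁻ : ∀ S → Realizable P (nonzero S) → Realizable P S
nonzero-realizable⁻ []                r           = r
nonzero-realizable⁻ ((0 , 0) ∷ S)     r           =
  source-realizable S (0∷-realizable S (nonzero-realizable⁻ S r))
nonzero-realizable⁻ ((0 , suc _) ∷ S) (_ , d , r) = _ , d , nonzero-realizable⁻ S r
nonzero-realizable⁻ ((suc _ , _) ∷ S) (_ , d , r) = _ , d , nonzero-realizable⁻ S r

-- Vanishing indegree is asked instead of `SourceTuple` because lowered sources may be zero tuples.
-- Entries pile up in reverse order, hence the permutation.
sources-realizable : ∀ {R} S → All (λ t → proj₁ t ≡ 0) R →
  Realizable (map proj₂ R ++ P) S → Realizable P (R ++ S)
sources-realizable S []                     r = r
sources-realizable S (_∷_ {xs = R} refl zs) r =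
  source-realizable (R ++ S) (sources-realizable S zs (realizable-↭ S (↭-sym (shift _ (map proj₂ R) _)) r))

sources-realizable⁻ : ∀ {R} S → All (λ t → proj₁ t ≡ 0) R →
  Realizable P (R ++ S) → Realizable (map proj₂ R ++ P) S
sources-realizable⁻ S []                     r = r
sources-realizable⁻ S (_∷_ {xs = R} refl zs) r =
  realizable-↭ S (shift _ (map proj₂ R) _) (sources-realizable⁻ S zs (source-realizable⁻ (R ++ S) r))

-- Exchange argument for the largest entries

-- If the next vertex draws on the first of the two entries only, then drawing
-- on the second one instead leaves the same list; in all other cases the same
-- choice is made and the difference between the two lists persists.
transfer : ∀ S → y ≤ x → Realizable (suc x ∷ y ∷ P) S → Realizable (x ∷ suc y ∷ P) S
transfer []            y≤x (() ∷ _)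
transfer ((_ , b) ∷ S) y≤x (_ , d , r) = step y≤x d r
  where
  transfer-under : y ≤ x → Realizable (b ∷ suc x ∷ y ∷ P) S → Realizable (b ∷ x ∷ suc y ∷ P) S
  transfer-under y≤x r = realizable-↭ S (shift b (_ ∷ _ ∷ []) _)
    (transfer S y≤x (realizable-↭ S (↭-sym (shift b (_ ∷ _ ∷ []) _)) r))

  step : y ≤ x → Decrement k (suc x ∷ y ∷ P) P′ → Realizable (b ∷ P′) S →
    ∃[ Q′ ] Decrement k (x ∷ suc y ∷ P) Q′ × Realizable (b ∷ Q′) S
  step y≤x       (skip (skip d))   r = _ , skip (skip d) , transfer-under y≤x r
  step y≤x       (lower (skip d))  r = _ , skip (lower d) , r
  step y<x       (skip (lower d))  r = _ , skip (lower d) , transfer-under (<⇒≤ y<x) r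
  -- The second entry is positive already before the transfer; the bound makes `x` positive too, so
  -- it can still be lowered.
  step (s≤s y≤x) (lower (lower d)) r = _ , lower (lower d) , transfer-under y≤x r

decrementFirst : ℕ → List ℕ → List ℕ
decrementFirst k P = map pred (take k P) ++ drop k P

decrementFirst-decrement : k ≤ length P → All (_> 0) P → Decrement k P (decrementFirst k P)
decrementFirst-decrement {zero}  {P}     _         _                  = decrement-none P
decrementFirst-decrement {suc _} {_ ∷ _} (s≤s k≤n) (s≤s _ ∷ positive) = lower (decrementFirst-decrement k≤n positive)

-- Undoes one `lower`: the entry is `y` in `P′` but stays `suc y` in `P″`, with the rest `Q` in
-- common. The bound is strict since `suc y` is an entry of `P`.
give-back : Decrement (suc k) P P′ → All (_≤ x) P →
  ∃[ y ] ∃[ Q ] ∃[ P″ ] y < x × P′ ↭ y ∷ Q × P″ ↭ suc y ∷ Q × Decrement k P P″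
give-back (lower d) (y<x ∷ _)       = _ , _ , _ , y<x , refl , refl , skip d
give-back (skip d)  (_ ∷ ≤x)        =
  let _ , _ , _ , y<x , p , q , e = give-back d ≤x
  in  _ , _ , _ , y<x , trans (prep _ p) (swap _ _ refl) , trans (prep _ q) (swap _ _ refl) , skip e

-- A largest entry that was spared can be exchanged, by a transfer, with any
-- entry that was decremented.
decrementFirst-optimal : ∀ Q S → Decrement k P P′ → AllPairs _≥_ P →
  Realizable (Q ++ P′) S → Realizable (Q ++ decrementFirst k P) S
decrementFirst-optimal {zero}  Q S d                    _             r with refl ← decrement-none⁻ d = r
-- `Q` is a passive context; a lowered head joins it before the tail is treated.
decrementFirst-optimal {suc k} Q S (lower {x = x} d)    (_ ∷ sorted)  r =
  realizable-↭ S (↭-sym (shift x Q _))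
    (decrementFirst-optimal (x ∷ Q) S d sorted (realizable-↭ S (shift x Q _) r))
decrementFirst-optimal {suc k} Q S (skip {x = zero} d)  (≤0 ∷ _)      r
  with give-back d ≤0
... | _ , _ , _ , () , _
decrementFirst-optimal {suc k} Q S (skip {x = suc x} d) (≤x ∷ sorted) r =
  -- The spared head `suc x` takes over the draw from the entry lowered to `y`: both move to the
  -- front, one unit is transferred, and `suc y` returns to the tail.
  let y , R , P″ , y<x , p , q , e = give-back d ≤x
      r₁ = realizable-↭ S (trans (++⁺ˡ Q (prep _ p)) (shifts Q (suc x ∷ y ∷ []))) r
      r₂ = transfer S (s≤s⁻¹ y<x) r₁
      r₃ = realizable-↭ S (prep x (trans (↭-sym (shift (suc y) Q R)) (++⁺ˡ Q (↭-sym q)))) r₂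
  in  realizable-↭ S (↭-sym (shift x Q _)) (decrementFirst-optimal (x ∷ Q) S e sorted r₃)

-- Counting with Boolean vectors

-- This form agrees by computation with the degrees in `Dag`.
size : (Fin m → Bool) → ℕ
size f = ∣ Vec.tabulate f ∣

bit : Bool → ℕ
bit b = if b then 1 else 0

size-∷ : (f : Fin (suc m) → Bool) → size f ≡ bit (f zero) + size (f ∘ suc)
size-∷ f with f zero
... | true  = refl
... | false = refl

size-false : (f : Fin m → Bool) → (∀ i → ¬ T (f i)) → size f ≡ 0
size-false {zero}  f none = refl
size-false {suc m} f none with f zero in eq
... | true  = ⊥-elim (none zero (subst T (sym eq) _))
... | false = size-false (f ∘ suc) (none ∘ suc)

-- A decrement amounts to a 0/1 vector `c`, the column of arcs into the next vertex.
decrement-tabulate : (c : Fin m → Bool) (f g : Vector.Vector ℕ m) → (∀ i → f i ≡ bit (c i) + g i) →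
  Decrement (size c) (tabulate f) (tabulate g)
decrement-tabulate {zero}  c f g eq = []
decrement-tabulate {suc m} c f g eq rewrite eq zero with c zero
... | true  = lower (decrement-tabulate (c ∘ suc) (f ∘ suc) (g ∘ suc) (eq ∘ suc))
... | false = skip (decrement-tabulate (c ∘ suc) (f ∘ suc) (g ∘ suc) (eq ∘ suc))

decrement-tabulate⁻ : (f : Vector.Vector ℕ m) → Decrement k (tabulate f) P →
  Σ[ c ∈ (Fin m → Bool) ] Σ[ g ∈ Vector.Vector ℕ m ]
    size c ≡ k × P ≡ tabulate g × (∀ i → f i ≡ bit (c i) + g i)
decrement-tabulate⁻ {zero}  f [] = (λ ()) , (λ ()) , refl , refl , λ ()
decrement-tabulate⁻ {suc m} f d with f zero in f₀
decrement-tabulate⁻ {suc m} f (skip d) | n =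
  let c , g , size≡ , P≡ , f≡ = decrement-tabulate⁻ (f ∘ suc) d
  in  (false Vector.∷ c) , (n Vector.∷ g) , size≡ , cong (n ∷_) P≡ ,
      λ { zero → f₀ ; (suc i) → f≡ i }
decrement-tabulate⁻ {suc m} f (lower d) | suc n =
  let c , g , size≡ , P≡ , f≡ = decrement-tabulate⁻ (f ∘ suc) d
  in  (true Vector.∷ c) , (n Vector.∷ g) , cong suc size≡ , cong (n ∷_) P≡ ,
      λ { zero → f₀ ; (suc i) → f≡ i }

-- Realizable sequences and dags

-- A dag on S with m further vertices put in front; the u-th of these has p u
-- outgoing arcs, all of them into S.
record Realization {m} (p : Vector.Vector ℕ m) (S : List Tuple) : Set where
  field
    earlier   : Fin m → Fin (length S) → Bool
    inner     : Fin (length S) → Fin (length S) → Bool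
    indegree  : ∀ v → size (flip earlier v) + size (flip inner v) ≡ proj₁ (lookup S v)
    pending   : ∀ u → size (earlier u) ≡ p u
    outdegree : ∀ v → size (inner v) ≡ proj₂ (lookup S v)
    forward   : ∀ u v → T (inner u v) → u Fin.< v

-- Regroups the arcs into a vertex: `x` is the arc from the head of the list, `y` counts arcs from
-- earlier vertices, `z` arcs from the tail.
commute-sum : ∀ {l} x y z → l ≡ x + z → (x + y) + z ≡ y + l
commute-sum x y z refl = ≡-trans (cong (_+ z) (+-comm x y)) (+-assoc y x z)

-- The head of the list joins the earlier vertices: its column of `earlier` is the choice of
-- entries, its row of `inner` becomes a row of `earlier`.
realization⇒realizable : ∀ S {p : Vector.Vector ℕ m} → Realization p S → Realizable (tabulate p) S
realization⇒realizable []            R = tabulate⁺ λ u → sym (pending u)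
  where open Realization R
realization⇒realizable ((a , b) ∷ S) {p} R =
  tabulate rest ,
  subst (λ k → Decrement k (tabulate p) (tabulate rest)) size≡a
    (decrement-tabulate (flip earlier zero) p rest (λ u → ≡-trans (sym (pending u)) (size-∷ (earlier u)))) ,
  realization⇒realizable S {b Vector.∷ rest} record
    { earlier   = rows
    ; inner     = λ u v → inner (suc u) (suc v)
    ; indegree  = λ v → ≡-trans
        (≡-trans (cong (_+ size (λ u → inner (suc u) (suc v))) (size-∷ (flip rows v)))
          (commute-sum (bit (inner zero (suc v))) _ _ (size-∷ (flip inner (suc v)))))
        (indegree (suc v))
    ; pending   = λ { zero → ≡-trans (sym (inner-row zero)) (outdegree zero) ; (suc u) → refl }
    ; outdegree = λ v → ≡-trans (sym (inner-row (suc v))) (outdegree (suc v))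
    ; forward   = λ u v e → s≤s⁻¹ (forward (suc u) (suc v) e)
    }
  where
  open Realization R

  rest : Vector.Vector ℕ _
  rest u = size (earlier u ∘ suc)

  rows : Fin (suc _) → Fin (length S) → Bool
  rows = (inner zero ∘ suc) Vector.∷ λ u → earlier u ∘ suc

  no-arc-to-zero : ∀ u → ¬ T (inner u zero)
  no-arc-to-zero u e with () ← forward u zero e

  -- Column zero of `inner` is empty, so all arcs into the head come from earlier vertices.
  size≡a : size (flip earlier zero) ≡ a
  size≡a = ≡-trans (sym (+-identityʳ _))
    (≡-trans (cong (size (flip earlier zero) +_) (sym (size-false (flip inner zero) no-arc-to-zero)))
      (indegree zero))

  inner-row : ∀ u → size (inner u) ≡ size (inner u ∘ suc)
  inner-row u with inner u zero | no-arc-to-zero u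
  ... | true  | none = ⊥-elim (none _)
  ... | false | _    = refl

-- Reverses the peeling: `c` becomes a new first column of `earlier`, and `inner` is bordered by the
-- new vertex's row and an empty column.
realizable⇒realization : ∀ S {p : Vector.Vector ℕ m} → Realizable (tabulate p) S → Realization p S
realizable⇒realization [] r = record
  { earlier   = λ _ ()
  ; inner     = λ ()
  ; indegree  = λ ()
  ; pending   = λ u → sym (tabulate⁻ r u)
  ; outdegree = λ ()
  ; forward   = λ ()
  }
realizable⇒realization ((a , b) ∷ S) {p} (_ , d , r)
  with c , rest , size≡a , refl , p≡ ← decrement-tabulate⁻ p d = record
  { earlier   = rows
  ; inner     = square
  ; indegree  = λ
      { zero    → ≡-trans (cong (size c +_) (size-false (flip square zero) no-arc-to-zero))
                    (≡-trans (+-identityʳ _) size≡a)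
      ; (suc v) → ≡-trans
          (sym (≡-trans (cong (_+ size (flip inner v)) (size-∷ (flip earlier v)))
            (commute-sum (bit (earlier zero v)) _ _ (size-∷ (flip square (suc v))))))
          (indegree v)
      }
  ; pending   = λ u → ≡-trans (size-∷ (rows u))
                  (≡-trans (cong (bit (c u) +_) (pending (suc u))) (sym (p≡ u)))
  ; outdegree = λ { zero → pending zero ; (suc v) → outdegree v }
  ; forward   = λ { zero (suc v) e → s≤s z≤n ; (suc u) (suc v) e → s≤s (forward u v e) }
  }
  where
  open Realization (realizable⇒realization S {b Vector.∷ rest} r)

  rows : Fin _ → Fin (suc (length S)) → Bool
  -- Row zero of the recursive `earlier` belongs to the new vertex, so `u` sits at `suc u`.
  rows u = c u Vector.∷ earlier (suc u)

  square : Fin (suc (length S)) → Fin (suc (length S)) → Bool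
  square = (false Vector.∷ earlier zero) Vector.∷ λ u → false Vector.∷ inner u

  no-arc-to-zero : ∀ u → ¬ T (square u zero)
  no-arc-to-zero zero    ()
  no-arc-to-zero (suc _) ()

dagSequence⇒realizable : DagSequence S → Realizable [] S
dagSequence⇒realizable {S} (G , ins , outs , topological) =
  realization⇒realizable S {λ ()} record
    { earlier   = λ ()
    ; inner     = Dag.adj G
    ; indegree  = ins
    ; pending   = λ ()
    ; outdegree = outs
    ; forward   = topological
    }

realizable⇒dagSequence : Realizable [] S → DagSequence S
realizable⇒dagSequence {S} r =
  -- Indices strictly increase along a path, so it cannot close up.
  record { adj = inner ; acyclic = λ v path → Fin.<-irrefl refl (ascending path) } ,
  indegree , outdegree , forward
  where
  open Realization (realizable⇒realization S {λ ()} r)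

  ascending : ∀ {u v} → TransClosure (λ u v → T (inner u v)) u v → u Fin.< v
  ascending [ e ]      = forward _ _ e
  ascending (e ∷ path) = Fin.<-trans (forward _ _ e) (ascending path)

-- Splitting off the sources and the reduction

take-lookup : ∀ {A : Set} {Pr : A → Set} q (xs : List A) →
  (∀ i → toℕ i < q → Pr (lookup xs i)) → All Pr (take q xs)
take-lookup zero    xs       pr = []
take-lookup (suc q) []       pr = []
take-lookup (suc q) (_ ∷ xs) pr = pr zero (s≤s z≤n) ∷ take-lookup q xs λ i i<q → pr (suc i) (s≤s i<q)

take++lookup∷drop : ∀ {A : Set} q (xs : List A) (q<n : q < length xs) →
  xs ≡ take q xs ++ lookup xs (fromℕ< q<n) ∷ drop (suc q) xs
take++lookup∷drop zero    (_ ∷ _)  _         = refl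
take++lookup∷drop (suc q) (x ∷ xs) (s≤s q<n) = cong (x ∷_) (take++lookup∷drop q xs q<n)

sum-sources : All SourceTuple S → sum (map proj₁ S) ≡ 0
sum-sources []                     = refl
sum-sources ((refl , _) ∷ sources) = sum-sources sources

-- The indegrees sum to 0 while some outdegree is positive. This provides the first non-source
-- tuple.
sources-unbalanced : S ≢ [] → All SourceTuple S → sum (map proj₁ S) ≢ sum (map proj₂ S)
sources-unbalanced nonempty []                         _  = nonempty refl
sources-unbalanced _        ((refl , s≤s _) ∷ sources) eq
  with () ← ≡-trans (sym (sum-sources sources)) eq

lemma1 : (S : List Tuple) (q : ℕ) →
    S ≢ [] →
    All (λ t → ¬ ZeroTuple t) S →
    sum (map proj₁ S) ≡ sum (map proj₂ S) →
    SourcesAreFirst q S →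
    OutdegreesNonincreasing (take q S) →
    Σ[ q<n ∈ q < length S ]
    (DagSequence S ⇔
    (proj₁ (firstNonSource S q q<n) ≤ q × DagSequence (reduced S q q<n)))
lemma1 S q nonempty _ balanced (q≤n , sources⇔) nonincreasing = q<n , mk⇔ to from
  where
  sources : List Tuple
  sources = take q S

  all-sources : All SourceTuple sources
  all-sources = take-lookup q S λ i → Equivalence.from (sources⇔ i)

  q<n : q < length S
  q<n with m≤n⇒m<n∨m≡n q≤n
  ... | inj₁ q<n  = q<n
  ... | inj₂ refl = ⊥-elim (sources-unbalanced nonempty
                      (subst (All SourceTuple) (take-all q S ≤-refl) all-sources) balanced)

  a₀ b₀ : ℕ
  a₀ = proj₁ (firstNonSource S q q<n)
  b₀ = proj₂ (firstNonSource S q q<n)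

  rest lowered : List Tuple
  rest    = drop (suc q) S
  lowered = map (map₂ pred) (take a₀ sources) ++ drop a₀ sources

  bs : List ℕ
  bs = map proj₂ sources

  length-bs : length bs ≡ q
  length-bs = ≡-trans (length-map proj₂ sources) (≡-trans (length-take q S) (m≤n⇒m⊓n≡m q≤n))

  S≡ : S ≡ sources ++ (a₀ , b₀) ∷ rest
  S≡ = take++lookup∷drop q S q<n

  zero-indegrees : All (λ t → proj₁ t ≡ 0) sources
  zero-indegrees = All.map proj₁ all-sources

  zero-indegrees-lowered : All (λ t → proj₁ t ≡ 0) lowered
  zero-indegrees-lowered = ++⁺ (map⁺ (take⁺ a₀ zero-indegrees)) (drop⁺ a₀ zero-indegrees)

  outdegrees-lowered : map proj₂ lowered ≡ decrementFirst a₀ bs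
  outdegrees-lowered = begin
    map proj₂ lowered
      ≡⟨ map-++ proj₂ (map (map₂ pred) (take a₀ sources)) (drop a₀ sources) ⟩
    map proj₂ (map (map₂ pred) (take a₀ sources)) ++ map proj₂ (drop a₀ sources)
      ≡⟨ cong₂ _++_ (≡-trans (sym (map-∘ (take a₀ sources))) (map-∘ (take a₀ sources)))
                    (sym (drop-map a₀ sources)) ⟩
    map pred (map proj₂ (take a₀ sources)) ++ drop a₀ bs
      ≡⟨ cong (λ xs → map pred xs ++ drop a₀ bs) (sym (take-map a₀ sources)) ⟩
    decrementFirst a₀ bs ∎
    where open ≡-Reasoning

  reduced≡ : reduced S q q<n ≡ nonzero (lowered ++ (0 , b₀) ∷ rest)
  reduced≡ = cong nonzero (sym (++-assoc (map (map₂ pred) (take a₀ sources)) (drop a₀ sources) _))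

  to : DagSequence S → a₀ ≤ q × DagSequence (reduced S q q<n)
  to dag =
    let P′ , d , r = subst (λ P → Realizable P ((a₀ , b₀) ∷ rest)) (++-identityʳ bs)
          (sources-realizable⁻ ((a₀ , b₀) ∷ rest) zero-indegrees
            (subst (Realizable []) S≡ (dagSequence⇒realizable dag)))
        -- The entry `b₀` of the non-source vertex is the context of the exchange.
        r′ = decrementFirst-optimal (b₀ ∷ []) rest d
               (Linked⇒AllPairs (flip ≤-trans) nonincreasing) r
    in  subst (a₀ ≤_) length-bs (decrement-≤length d) ,
        realizable⇒dagSequence (subst (Realizable []) (sym reduced≡)
          (nonzero-realizable (lowered ++ (0 , b₀) ∷ rest)
            (sources-realizable ((0 , b₀) ∷ rest) zero-indegrees-lowered
              (subst (λ P → Realizable P ((0 , b₀) ∷ rest))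
                (≡-trans (sym outdegrees-lowered) (sym (++-identityʳ (map proj₂ lowered))))
                (source-realizable rest r′)))))

  from : a₀ ≤ q × DagSequence (reduced S q q<n) → DagSequence S
  from (a₀≤q , dag) =
    let r = subst (λ P → Realizable P ((0 , b₀) ∷ rest))
              (≡-trans (++-identityʳ (map proj₂ lowered)) outdegrees-lowered)
              (sources-realizable⁻ ((0 , b₀) ∷ rest) zero-indegrees-lowered
                (nonzero-realizable⁻ (lowered ++ (0 , b₀) ∷ rest)
                  (subst (Realizable []) reduced≡ (dagSequence⇒realizable dag))))
        -- Lowering the first `a₀` entries is a legal choice: `a₀ ≤ q` keeps `take` from truncating,
        -- and positive outdegrees make `pred` exact.
        d = decrementFirst-decrement (subst (a₀ ≤_) (sym length-bs) a₀≤q)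
              (map⁺ (All.map proj₂ all-sources))
    in  realizable⇒dagSequence (subst (Realizable []) (sym S≡)
          (sources-realizable ((a₀ , b₀) ∷ rest) zero-indegrees
            (subst (λ P → Realizable P ((a₀ , b₀) ∷ rest)) (sym (++-identityʳ bs))
              (_ , d , source-realizable⁻ rest r))))
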